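{- Let $\mathcal G=((V,E),(V_1,V_2))$ be a game graph with GR(1) objective $\bigwedge_{t=1}^{k_1}\text{Büchi}(L_t)\rightarrow\bigwedge_{\ell=1}^{k_2}\text{Büchi}(U_\ell)$ for player 1, and let $V^{j^*}$ be the set of vertices returned by Algorithm GR(1)Game (described in the context) on this input. Then each vertex in $V\setminus V^{j^*}$ is winning for player 2, i.e. from each such vertex player 2 has a strategy in $\mathcal G$ ensuring that the GR(1) objective is violated.
   Context: **Games.** A game graph $\mathcal G=((V,E),(V_1,V_2))$ is a finite directed graph with a partition of $V$ into player-1 vertices $V_1$ and player-2 vertices $V_2$, every vertex having at least one outgoing edge; $n=|V|$, $m=|E|$. $\overline{\mathcal G}=((V,E),(V_2,V_1))$ swaps the players. $\mathrm{Out},\mathrm{In}$ denote successor and predecessor sets, $\mathrm{Outdeg}(v)=|\mathrm{Out}(v)|$ (a graph is added as an argument if needed). A play is an infinite path; at a vertex of $V_p$ player $p$ picks the successor by a strategy (function of the history). $\text{Büchi}(T)$ is the set of plays visiting $T$ infinitely often. A generalized Büchi objective is a conjunction of Büchi objectives; the GR(1) objective $\bigwedge_{t=1}^{k_1}\text{Büchi}(L_t)\rightarrow\bigwedge_{\ell=1}^{k_2}\text{Büchi}(U_\ell)$ is the set of plays that satisfy the second conjunction or violate the first. Player 2 has the complement of player 1's objective. $W_p(\mathcal G,\psi)$ is the set of vertices from which player $p$ has a winning strategy when player 1's objective is $\psi$. **Attractors.** For $p\in\{1,2\}$ with opponent $\bar p$ and $X\subseteq V$: $R_0=X$, $R_{j+1}=R_j\cup\{v\in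 V_p\mid \mathrm{Out}(v)\cap R_j\ne\emptyset\}\cup\{v\in V_{\bar p}\mid \mathrm{Out}(v)\subseteq R_j\}$, $\mathit{Attr}_p(\mathcal G,X)=\bigcup_j R_j$. $\mathcal G\setminus X$ is the game graph induced by $V\setminus X$. **Hierarchical graph decomposition.** For a game graph on $G=(V,E)$, fix for each vertex an order of its incoming edges in which edges from $V_2$ precede edges from $V_1$. For $i\ge1$, $G_i=(V,E_i)$, where $E_i$ contains all outgoing edges of every $v$ with $\mathrm{Outdeg}(G,v)\le 2^i$ and the first $2^i$ incoming edges of every vertex; $\mathcal G_i=(G_i,(V_1,V_2))$. **Subroutines.** GenBüchiGame$(\mathcal H,\psi)$, for a generalized Büchi objective $\psi$ of player 1 in $\mathcal H$, returns $W_1(\mathcal H,\psi)$. GenBüchiProgressMeasure$(\mathcal H,\psi,h)$ returns either the empty set or a player-1 dominion of $\mathcal H$ w.r.t. $\psi$ (a non-empty vertex set $D$ such that player 1 has, from every vertex of $D$, a strategy that is winning for $\psi$ and ensures that only vertices of $D$ are visited); if there is a player-1 dominion of size at most $h$, it returns a player-1 dominion containing all player-1 dominions of size at most $h$. **Procedure kGenBüchiDominion**$(\mathcal G^j,\{U^j_\ell\},\{L^j_t\},h_{\max})$. For $i=1,\dots,\lceil\log_2(2h_{\max})\rceil$: construct $G^j_i$ (the $i$th graph of the decomposition of the graph $G^j$ of $\mathcal G^j$, with vertex set $V^j$); let $Z^j_i=\{v\in V_2\cap V^j\mid \mathrm{Outdeg}(G^j_i,v)=0\}\cup\{v\in V_1\cap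 V^j\mid\mathrm{Outdeg}(G^j,v)>2^i\}$; for $\ell=1,\dots,k_2$: let $Y^j_{i,\ell}=\mathit{Attr}_1(\mathcal G^j_i,U^j_\ell\cup Z^j_i)$ and $X^j_{i,\ell}=$ GenBüchiProgressMeasure$(\overline{\mathcal G^j_i\setminus Y^j_{i,\ell}},\bigwedge_{t=1}^{k_1}\text{Büchi}(L^j_t\setminus Y^j_{i,\ell}),2^i)$; if $X^j_{i,\ell}\ne\emptyset$, return $X^j_{i,\ell}$. If nothing was returned, return $\emptyset$. **Algorithm GR(1)Game.** Set $\mathcal G^1=\mathcal G$, $U^1_\ell=U_\ell$, $L^1_t=L_t$. For $j=1,2,\dots$: let $V^j$ be the vertex set of $\mathcal G^j$ and $S^j=$ kGenBüchiDominion$(\mathcal G^j,\{U^j_\ell\},\{L^j_t\},\sqrt n)$, where $n=|V|$. If $S^j=\emptyset$, then for $\ell=1,\dots,k_2$: let $Y^j_\ell=\mathit{Attr}_1(\mathcal G^j,U^j_\ell)$ and $S^j=$ GenBüchiGame$(\overline{\mathcal G^j\setminus Y^j_\ell},\bigwedge_{t=1}^{k_1}\text{Büchi}(L^j_t\setminus Y^j_\ell))$, leaving this loop as soon as $S^j\ne\emptyset$. Then let $D^j=\mathit{Attr}_2(\mathcal G^j,S^j)$, $\mathcal G^{j+1}=\mathcal G^j\setminus D^j$, $U^{j+1}_\ell=U^j_\ell\setminus D^j$, $L^{j+1}_t=L^j_t\setminus D^j$. If $D^j=\emptyset$, stop and return $V^j$ (this $j$ is denoted $j^*$). -}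

module Defs where

open import Data.Bool using (if_then_else_; true)
open import Data.Empty using (⊥-elim)
open import Data.Fin using (Fin)
open import Data.Fin.Properties using (_≟_)
open import Data.Fin.Subset
open import Data.Fin.Subset.Properties
  using (_∈?_; _⊆?_; nonempty?; ∈⊤; ⊆-antisym; ∣p∣≤n; ∣p∣≡n⇒p≡⊤; p⊂q⇒∣p∣<∣q∣)
open import Data.List using (List; []; _∷_; map; take; upTo; allFin; applyDownFrom)
open import Data.List.Membership.Propositional using () renaming (_∈_ to _∈ˡ_)
import Data.List.Membership.DecPropositional as DecMembership
open import Data.List.Relation.Unary.AllPairs using (AllPairs)
open import Data.List.Relation.Unary.Unique.Propositional using (Unique)
open import Data.Nat using (ℕ; zero; suc; _+_; _*_; _^_; _≤_; _<_; _≤?_; _<?_; ⌈_/2⌉; z≤n; s≤s)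
import Data.Nat.Properties as ℕ
open import Data.Nat.Logarithm using (⌈log₂_⌉)
open import Data.Product using (Σ-syntax; ∃-syntax; _×_; _,_; proj₁)
open import Data.Sum using (_⊎_; inj₁; inj₂)
open import Data.Vec using (tabulate)
open import Data.Vec.Properties using (lookup∘tabulate; []=⇒lookup; lookup⇒[]=)
open import Function using (_∘_; _⇔_; mk⇔; Equivalence)
open import Relation.Binary.PropositionalEquality using (_≡_; refl; sym; trans; subst)
open import Relation.Nullary using (Dec; ¬_; yes; no; does; contradiction; ¬?; _×-dec_; _⊎-dec_)
open import Relation.Nullary.Decidable using (dec-true)
open import Relation.Unary using (Decidable)

private
  variable
    N k k₁ k₂ : ℕ

module _ {P : Fin N → Set} where

  ⟪_⟫ : Decidable P → Subset N
  ⟪ P? ⟫ = tabulate (does ∘ P?)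

  ∈⟪⟫ : (P? : Decidable P) → ∀ {v} → v ∈ ⟪ P? ⟫ ⇔ P v
  ∈⟪⟫ P? {v} = mk⇔ to from
    where
    to : v ∈ ⟪ P? ⟫ → P v
    to v∈ with P? v | trans (sym (lookup∘tabulate (does ∘ P?) v)) ([]=⇒lookup v∈)
    ... | yes p | _ = p
    ... | no _  | ()

    from : P v → v ∈ ⟪ P? ⟫
    from p = lookup⇒[]= v _ (trans (lookup∘tabulate (does ∘ P?) v) (dec-true (P? v) p))

data Player : Set where
  p1 p2 : Player

opponent : Player → Player
opponent p1 = p2
opponent p2 = p1

_≟ᴾ_ : (p q : Player) → Dec (p ≡ q)
p1 ≟ᴾ p1 = yes refl
p1 ≟ᴾ p2 = no λ ()
p2 ≟ᴾ p1 = no λ ()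
p2 ≟ᴾ p2 = yes refl

-- All graphs live in a fixed ambient finite set Fin N, so that the
-- subgraphs formed by the algorithm share vertex names with the input.
-- V_p is the set of v ∈ V with owner v ≡ p; owners of vertices outside V
-- are meaningless.  The graphs G_i of the decomposition may have vertices
-- without successors, hence the conditions on game graphs are kept apart,
-- in IsGameGraph.

record Graph (N : ℕ) : Set where
  field
    V     : Subset N
    Out   : Fin N → Subset N
    owner : Fin N → Player

open Graph public

record IsGameGraph (G : Graph N) : Set where
  field
    source-in : ∀ {u v} → v ∈ Out G u → u ∈ V G
    target-in : ∀ {u v} → v ∈ Out G u → v ∈ V G
    total     : ∀ {v} → v ∈ V G → Nonempty (Out G v)

_∈V[_]_ : Fin N → Player → Graph N → Set
v ∈V[ p ] G = v ∈ V G × owner G v ≡ p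

_∈V[_]?_ : (v : Fin N) (p : Player) (G : Graph N) → Dec (v ∈V[ p ] G)
v ∈V[ p ]? G = (v ∈? V G) ×-dec (owner G v ≟ᴾ p)

Outdeg : Graph N → Fin N → ℕ
Outdeg G v = ∣ Out G v ∣

swap : Graph N → Graph N
swap G = record { V = V G ; Out = Out G ; owner = opponent ∘ owner G }

infixl 5 _∖_

_∖_ : Graph N → Subset N → Graph N
G ∖ X = record
  { V     = V G ─ X
  ; Out   = λ v → if does (v ∈? X) then ⊥ else Out G v ─ X
  ; owner = owner G
  }

record IsPlay (G : Graph N) (π : ℕ → Fin N) : Set where
  field
    start : π 0 ∈ V G
    step  : ∀ i → π (suc i) ∈ Out G (π i)

-- A history is given as its last vertex together with the list of all
-- earlier vertices, most recent first.

record Strategy (p : Player) (G : Graph N) : Set where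
  field
    move  : List (Fin N) → Fin N → Fin N
    legal : ∀ past {v} → v ∈V[ p ] G → move past v ∈ Out G v

open Strategy public

Conforms : ∀ {p} {G : Graph N} → Strategy p G → (ℕ → Fin N) → Set
Conforms {p = p} {G} σ π =
  ∀ i → π i ∈V[ p ] G → π (suc i) ≡ move σ (applyDownFrom π i) (π i)

Objective : ℕ → Set₁
Objective N = (ℕ → Fin N) → Set

Büchi : Subset N → Objective N
Büchi T π = ∀ i → ∃[ j ] i ≤ j × π j ∈ T

GenBüchi : (Fin k → Subset N) → Objective N
GenBüchi T π = ∀ t → Büchi (T t) π

GR1 : (Fin k₁ → Subset N) → (Fin k₂ → Subset N) → Objective N
GR1 L U π = GenBüchi U π ⊎ ¬ GenBüchi L π

objectiveOf : Player → Objective N → Objective N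
objectiveOf p1 ψ = ψ
objectiveOf p2 ψ = ¬_ ∘ ψ

WinsFrom : (p : Player) (G : Graph N) → Objective N → Strategy p G → Fin N → Set
WinsFrom p G φ σ v = ∀ π → IsPlay G π → π 0 ≡ v → Conforms σ π → φ π

-- As everywhere, ψ is player 1's objective, also for p = p2.

W : Player → Graph N → Objective N → Fin N → Set
W p G ψ v = v ∈ V G × Σ[ σ ∈ Strategy p G ] WinsFrom p G (objectiveOf p ψ) σ v

record IsDominion₁ (G : Graph N) (ψ : Objective N) (D : Subset N) : Set where
  field
    within   : D ⊆ V G
    nonempty : Nonempty D
    winning  : ∀ {v} → v ∈ D →
               Σ[ σ ∈ Strategy p1 G ] WinsFrom p1 G (λ π → ψ π × (∀ i → π i ∈ D)) σ v

attrStep? : (p : Player) (G : Graph N) (A : Subset N) → Decidable λ v →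
  v ∈ A
  ⊎ (v ∈V[ p ] G × Nonempty (Out G v ∩ A))
  ⊎ (v ∈V[ opponent p ] G × Out G v ⊆ A)
attrStep? p G A v =
  (v ∈? A)
  ⊎-dec ((v ∈V[ p ]? G) ×-dec nonempty? (Out G v ∩ A))
  ⊎-dec ((v ∈V[ opponent p ]? G) ×-dec (Out G v ⊆? A))

R : Player → Graph N → Subset N → ℕ → Subset N
R p G X zero    = X
R p G X (suc j) = ⟪ attrStep? p G (R p G X j) ⟫

-- The chain R_0 ⊆ R_1 ⊆ … stabilises after at most N steps, so R_N is the
-- union of all R_j; see ∈Attr below.

Attr : Player → Graph N → Subset N → Subset N
Attr {N} p G X = R p G X N

module _ (p : Player) (G : Graph N) (X : Subset N) where
  private
    Rⱼ = R p G X

  R-suc : ∀ j → Rⱼ j ⊆ Rⱼ (suc j)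
  R-suc j v∈ = Equivalence.from (∈⟪⟫ (attrStep? p G (Rⱼ j))) (inj₁ v∈)

  R-mono : ∀ {i j} → i ≤ j → Rⱼ i ⊆ Rⱼ j
  R-mono {j = zero} z≤n v∈ = v∈
  R-mono {i} {suc j} i≤ v∈ with ℕ.m≤n⇒m<n∨m≡n i≤
  ... | inj₁ (s≤s i≤j) = R-suc j (R-mono {i} {j} i≤j v∈)
  ... | inj₂ refl      = v∈

  private
    next-⊆ : ∀ {A B} → A ⊆ B → B ⊆ A →
             ⟪ attrStep? p G A ⟫ ⊆ ⟪ attrStep? p G B ⟫
    next-⊆ A⊆B B⊆A v∈ =
      subst (λ S → _ ∈ ⟪ attrStep? p G S ⟫)
            (⊆-antisym A⊆B B⊆A) v∈

    stable : ∀ {j} → Rⱼ (suc j) ⊆ Rⱼ j → ∀ i → Rⱼ i ⊆ Rⱼ j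
    stable {j} st zero    v∈ = R-mono {0} {j} z≤n v∈
    stable {j} st (suc i) v∈ with i ≤? j
    ... | yes i≤j = st (R-mono {suc i} {suc j} (s≤s i≤j) v∈)
    ... | no i≰j  =
      st (next-⊆ (stable {j} st i) (R-mono {j} {i} (ℕ.<⇒≤ (ℕ.≰⇒> i≰j))) v∈)

    new? : ∀ j → Decidable λ v → v ∈ Rⱼ (suc j) × v ∉ Rⱼ j
    new? j v = (v ∈? Rⱼ (suc j)) ×-dec ¬? (v ∈? Rⱼ j)

    grows-or-stable : ∀ j → j ≤ ∣ Rⱼ j ∣ ⊎ (∀ i → Rⱼ i ⊆ Rⱼ j)
    grows-or-stable zero = inj₁ z≤n
    grows-or-stable (suc j) with grows-or-stable j
    ... | inj₂ st = inj₂ λ i v∈ → R-suc j (st i v∈)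
    ... | inj₁ j≤ with Rⱼ (suc j) ⊆? Rⱼ j
    ...   | yes st = inj₂ λ i v∈ → R-suc j (stable {j} st i v∈)
    ...   | no ¬st with nonempty? ⟪ new? j ⟫
    ...     | yes (v , v∈) = inj₁ (ℕ.≤-trans (s≤s j≤) (p⊂q⇒∣p∣<∣q∣
                (R-suc j , v , Equivalence.to (∈⟪⟫ (new? j)) v∈)))
    ...     | no empty = ⊥-elim (¬st incl)
      where
      incl : Rⱼ (suc j) ⊆ Rⱼ j
      incl {v} v∈ with v ∈? Rⱼ j
      ... | yes q = q
      ... | no v∉ = contradiction (v , Equivalence.from (∈⟪⟫ (new? j)) (v∈ , v∉)) empty

    bound : ∀ j → Rⱼ j ⊆ Rⱼ N
    bound j v∈ with grows-or-stable N
    ... | inj₂ st = st j v∈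
    ... | inj₁ N≤ = subst (_ ∈_) (sym (full N≤)) ∈⊤
      where
      full : N ≤ ∣ Rⱼ N ∣ → Rⱼ N ≡ ⊤
      full N≤ = ∣p∣≡n⇒p≡⊤ (ℕ.≤-antisym (∣p∣≤n (Rⱼ N)) N≤)

  ∈Attr : ∀ {v} → v ∈ Attr p G X ⇔ (∃[ j ] v ∈ R p G X j)
  ∈Attr = mk⇔ (N ,_) λ (j , v∈) → bound j v∈

-- An order of the incoming edges of v is given by the list us of their
-- sources; the graphs are simple.

record IsInOrder (G : Graph N) (v : Fin N) (us : List (Fin N)) : Set where
  field
    unique   : Unique us
    sources  : ∀ u → u ∈ˡ us ⇔ v ∈ Out G u
    p2-first : AllPairs (λ u w → owner G u ≡ p1 → owner G w ≡ p1) us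

decomp : (Fin N → List (Fin N)) → Graph N → ℕ → Graph N
decomp order G i = record
  { V     = V G
  ; Out   = λ u → ⟪ (λ v → (v ∈? Out G u)
                      ×-dec ((Outdeg G u ≤? 2 ^ i) ⊎-dec (u ∈ˡ? take (2 ^ i) (order v)))) ⟫
  ; owner = owner G
  }
  where open DecMembership _≟_ renaming (_∈?_ to _∈ˡ?_)

-- The choices the algorithm leaves open: the orders of incoming edges, and
-- the two subroutines, constrained only by their contracts on game graphs.

record Subroutines (N : ℕ) : Set₁ where
  field
    inOrder : Graph N → Fin N → List (Fin N)
    inOrder-spec : ∀ G → IsGameGraph G → ∀ {v} → v ∈ V G → IsInOrder G v (inOrder G v)

    genBüchiGame : Graph N → (Fin k → Subset N) → Subset N
    genBüchiGame-spec :
      ∀ H → IsGameGraph H → (T : Fin k → Subset N) → (∀ t → T t ⊆ V H) →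
      ∀ v → v ∈ genBüchiGame H T ⇔ W p1 H (GenBüchi T) v

    progressMeasure : Graph N → (Fin k → Subset N) → ℕ → Subset N
    progressMeasure-sound :
      ∀ H → IsGameGraph H → (T : Fin k → Subset N) → (∀ t → T t ⊆ V H) → ∀ h →
      Empty (progressMeasure H T h) ⊎ IsDominion₁ H (GenBüchi T) (progressMeasure H T h)
    progressMeasure-complete :
      ∀ H → IsGameGraph H → (T : Fin k → Subset N) → (∀ t → T t ⊆ V H) → ∀ h →
      (∃[ D ] IsDominion₁ H (GenBüchi T) D × ∣ D ∣ ≤ h) →
      IsDominion₁ H (GenBüchi T) (progressMeasure H T h)
      × (∀ D → IsDominion₁ H (GenBüchi T) D → ∣ D ∣ ≤ h → D ⊆ progressMeasure H T h)

-- A loop that is left at the first non-empty set it computes.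

firstNonempty : List (Subset N) → Subset N
firstNonempty []       = ⊥
firstNonempty (X ∷ Xs) = if does (nonempty? X) then X else firstNonempty Xs

-- ⌈log₂ (2 √s)⌉ = ⌈½ log₂ (4 s)⌉, without real numbers.

⌈log₂2√_⌉ : ℕ → ℕ
⌈log₂2√ s ⌉ = ⌈ ⌈log₂ (4 * s) ⌉ /2⌉

record State (N k₁ k₂ : ℕ) : Set where
  field
    graph : Graph N
    Us    : Fin k₂ → Subset N
    Ls    : Fin k₁ → Subset N

open State public

module Algorithm (sub : Subroutines N) where
  open Subroutines sub

  module Dominion (G : Graph N) (U : Fin k₂ → Subset N) (L : Fin k₁ → Subset N) where

    Gᵢ : ℕ → Graph N
    Gᵢ = decomp (inOrder G) G

    Zᵢ : ℕ → Subset N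
    Zᵢ i = ⟪ (λ v → (v ∈V[ p2 ]? G) ×-dec (Outdeg (Gᵢ i) v ℕ.≟ 0)) ⟫
         ∪ ⟪ (λ v → (v ∈V[ p1 ]? G) ×-dec (2 ^ i <? Outdeg G v)) ⟫

    Yᵢ : ℕ → Fin k₂ → Subset N
    Yᵢ i ℓ = Attr p1 (Gᵢ i) (U ℓ ∪ Zᵢ i)

    Xᵢ : ℕ → Fin k₂ → Subset N
    Xᵢ i ℓ = progressMeasure (swap (Gᵢ i ∖ Yᵢ i ℓ)) (λ t → L t ─ Yᵢ i ℓ) (2 ^ i)

    -- The parameter h_max, a square root when the procedure is called, is
    -- passed as its square s.
    kGenBüchiDominion : ℕ → Subset N
    kGenBüchiDominion s =
      firstNonempty (map (λ i → firstNonempty (map (Xᵢ i) (allFin k₂)))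
                         (map suc (upTo ⌈log₂2√ s ⌉)))

  open Dominion public using (kGenBüchiDominion)

  module Iteration (n : ℕ) (st : State N k₁ k₂) where

    Y : Fin k₂ → Subset N
    Y ℓ = Attr p1 (graph st) (Us st ℓ)

    S : Subset N
    S = firstNonempty
      ( kGenBüchiDominion (graph st) (Us st) (Ls st) n
      ∷ map (λ ℓ → genBüchiGame (swap (graph st ∖ Y ℓ)) (λ t → Ls st t ─ Y ℓ)) (allFin k₂))

    D : Subset N
    D = Attr p2 (graph st) S

    next : State N k₁ k₂
    next = record
      { graph = graph st ∖ D
      ; Us    = λ ℓ → Us st ℓ ─ D
      ; Ls    = λ t → Ls st t ─ D
      }

  module Run (G : Graph N) (U : Fin k₂ → Subset N) (L : Fin k₁ → Subset N) where

    -- Iterations are counted from 0 here: state j consists of G^{j+1},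
    -- U^{j+1}, L^{j+1}.  The sequence is also defined past termination.
    state : ℕ → State N k₁ k₂
    state zero    = record { graph = G ; Us = U ; Ls = L }
    state (suc j) = Iteration.next ∣ V G ∣ (state j)

    Dʲ : ℕ → Subset N
    Dʲ j = Iteration.D ∣ V G ∣ (state j)

    Vʲ : ℕ → Subset N
    Vʲ j = V (graph (state j))

    StopsAt : ℕ → Set
    StopsAt j = Empty (Dʲ j) × (∀ i → i < j → Nonempty (Dʲ i))

  -- GR(1)Game, run on G with the given targets, returns the set V*.
  GR1GameReturns : Graph N → (Fin k₁ → Subset N) → (Fin k₂ → Subset N) → Subset N → Set
  GR1GameReturns G L U V* = ∃[ j ] StopsAt j × V* ≡ Vʲ j
    where open Run G U L

{-# OPTIONS --safe #-}

-- Winning for player 2 is a tail property, so player 2 may play towards a set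
-- of vertices from which she wins and start afresh on entering it.  This is
-- used along the levels of an attractor to S^j, and along the iterations:
-- before entering D^j she plays a winning strategy of G^{j+1}.  On S^j she wins
-- because S^j comes from a subgame that is the complement of a player-1
-- attractor to U_ℓ: player 1 cannot leave it, so U_ℓ is never visited, while
-- her strategy there visits every L_t infinitely often.

module Submission where

open import Data.Empty using (⊥-elim)
open import Data.Fin using (Fin)
open import Data.Fin.Properties using (_≟_)
open import Data.Fin.Subset using (Subset; inside; outside; _∈_; _∉_; _⊆_; _─_; _∩_; _∪_; Nonempty; ∣_∣)
open import Data.Fin.Subset.Properties
  using (_∈?_; nonempty?; ∉⊥; ∣⊥∣≡0; Empty-unique; p─q⊆p; x∈p∧x∉q⇒x∈p─q;
         x∈p∩q⁺; x∈p∩q⁻; p⊆p∪q; x∈p∪q⁺)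
open import Data.List using (List; []; _∷_; map; take; upTo; allFin; applyDownFrom)
open import Data.List.Membership.Propositional using () renaming (_∈_ to _∈ˡ_)
import Data.List.Membership.DecPropositional as DecMembership
open import Data.Maybe using (Maybe; just; nothing)
open import Data.Nat using (ℕ; zero; suc; _+_; _∸_; _^_; _≤_; _<_; _≤?_; _<?_; s≤s)
import Data.Nat.Induction as ℕ
import Data.Nat.Properties as ℕ
open import Data.Product using (∃-syntax; _×_; _,_; proj₁; proj₂)
open import Data.Sum using (_⊎_; inj₁; inj₂)
open import Data.Vec using (there; _∷_)
open import Function using (_∘_; Equivalence)
open import Relation.Binary.PropositionalEquality
  using (_≡_; refl; sym; trans; cong; subst)
open import Relation.Nullary using (¬_; yes; no; contradiction; _×-dec_; _⊎-dec_)
open import Relation.Unary using (Decidable)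
open import Defs

private
  variable
    N k₁ k₂ : ℕ

-- Finite subsets and first non-empty sets.

∈─⇒∉ : ∀ (p q : Subset N) {x} → x ∈ p ─ q → x ∉ q
∈─⇒∉ (_ ∷ p) (inside  ∷ q) (there x∈) (there x∈q) = ∈─⇒∉ p q x∈ x∈q
∈─⇒∉ (_ ∷ p) (outside ∷ q) (there x∈) (there x∈q) = ∈─⇒∉ p q x∈ x∈q

─-monoˡ : ∀ {p q : Subset N} (r : Subset N) → p ⊆ q → p ─ r ⊆ q ─ r
─-monoˡ {p = p} r p⊆q x∈ = x∈p∧x∉q⇒x∈p─q (p⊆q (p─q⊆p p r x∈)) (∈─⇒∉ p r x∈)

⊈⇒Nonempty-─ : ∀ (p q : Subset N) → ¬ p ⊆ q → Nonempty (p ─ q)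
⊈⇒Nonempty-─ p q p⊈q with nonempty? (p ─ q)
... | yes ne = ne
... | no empty = ⊥-elim (p⊈q p⊆q)
  where
  p⊆q : p ⊆ q
  p⊆q {x} x∈p with x ∈? q
  ... | yes x∈q = x∈q
  ... | no x∉q  = contradiction (x , x∈p∧x∉q⇒x∈p─q x∈p x∉q) empty

∣p∣≢0⇒Nonempty : ∀ (p : Subset N) → ¬ ∣ p ∣ ≡ 0 → Nonempty p
∣p∣≢0⇒Nonempty {N} p ∣p∣≢0 with nonempty? p
... | yes ne = ne
... | no empty =
  contradiction (trans (cong ∣_∣ (Empty-unique empty)) (∣⊥∣≡0 N)) ∣p∣≢0

∈firstNonempty⁻ : ∀ (X : Subset N) Xs {v} → v ∈ firstNonempty (X ∷ Xs) →
                  v ∈ X ⊎ v ∈ firstNonempty Xs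
∈firstNonempty⁻ X Xs v∈ with nonempty? X
... | yes _ = inj₁ v∈
... | no _  = inj₂ v∈

∈firstNonempty-map⁻ : ∀ {A : Set} (f : A → Subset N) xs {v} →
                      v ∈ firstNonempty (map f xs) → ∃[ x ] v ∈ f x
∈firstNonempty-map⁻ f [] v∈ = contradiction v∈ ∉⊥
∈firstNonempty-map⁻ f (x ∷ xs) v∈ with ∈firstNonempty⁻ (f x) (map f xs) v∈
... | inj₁ v∈fx = x , v∈fx
... | inj₂ v∈xs = ∈firstNonempty-map⁻ f xs v∈xs

-- Induced subgraphs and complements of attractors.

module _ (G : Graph N) (X : Subset N) where

  ∈Out-∖⁻ : ∀ {u v} → v ∈ Out (G ∖ X) u → u ∉ X × v ∈ Out G u × v ∉ X
  ∈Out-∖⁻ {u} v∈ with u ∈? X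
  ... | yes _  = contradiction v∈ ∉⊥
  ... | no u∉X = u∉X , p─q⊆p (Out G u) X v∈ , ∈─⇒∉ (Out G u) X v∈

  ∈Out-∖⁺ : ∀ {u v} → u ∉ X → v ∈ Out G u → v ∉ X → v ∈ Out (G ∖ X) u
  ∈Out-∖⁺ {u} u∉X v∈ v∉X with u ∈? X
  ... | yes u∈X = contradiction u∈X u∉X
  ... | no _    = x∈p∧x∉q⇒x∈p─q v∈ v∉X

own-or-opponent : ∀ p q → q ≡ p ⊎ q ≡ opponent p
own-or-opponent p1 p1 = inj₁ refl
own-or-opponent p1 p2 = inj₂ refl
own-or-opponent p2 p1 = inj₂ refl
own-or-opponent p2 p2 = inj₁ refl

module _ (p : Player) (G : Graph N) (X : Subset N) where
  private
    A = Attr p G X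

    ∈R-suc : ∀ j {v} → _ → v ∈ R p G X (suc j)
    ∈R-suc j {v} = Equivalence.from (∈⟪⟫ (attrStep? p G (R p G X j)) {v})

    closed : R p G X (suc N) ⊆ A
    closed v∈ = Equivalence.from (∈Attr p G X) (suc N , v∈)

  ⊆Attr : X ⊆ A
  ⊆Attr v∈ = Equivalence.from (∈Attr p G X) (0 , v∈)

  Attr-own : ∀ {v} → v ∈V[ p ] G → Nonempty (Out G v ∩ A) → v ∈ A
  Attr-own v∈ ne = closed (∈R-suc N (inj₂ (inj₁ (v∈ , ne))))

  Attr-opponent : ∀ {v} → v ∈V[ opponent p ] G → Out G v ⊆ A → v ∈ A
  Attr-opponent v∈ out⊆ = closed (∈R-suc N (inj₂ (inj₂ (v∈ , out⊆))))

  -- Outside the attractor, a vertex of `opponent p` keeps some edge, or it would be absorbed, and a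
  -- vertex of `p` keeps every edge, since an edge into `A` would absorb it. Dead ends of `G` are
  -- tolerated inside `X`, because the graphs of the decomposition may have them.
  ∖Attr-game : (∀ {u v} → v ∈ Out G u → u ∈ V G × v ∈ V G) →
               (∀ {v} → v ∈ V G → v ∉ X → Nonempty (Out G v)) →
               IsGameGraph (G ∖ A)
  ∖Attr-game ends total = record
    { source-in = λ v∈ → let u∉ , v∈ , _ = ∈Out-∖⁻ G A v∈
                         in x∈p∧x∉q⇒x∈p─q (proj₁ (ends v∈)) u∉
    ; target-in = λ v∈ → let _ , v∈ , v∉ = ∈Out-∖⁻ G A v∈
                         in x∈p∧x∉q⇒x∈p─q (proj₂ (ends v∈)) v∉
    ; total     = total′
    }
    where
    total′ : ∀ {v} → v ∈ V (G ∖ A) → Nonempty (Out (G ∖ A) v)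
    total′ {v} v∈ = edge (by (owner G v) refl)
      where
      v∉A = ∈─⇒∉ (V G) A v∈
      v∈G = p─q⊆p (V G) A v∈

      edge : Nonempty (Out G v ─ A) → Nonempty (Out (G ∖ A) v)
      edge (w , w∈) = w , ∈Out-∖⁺ G A v∉A (p─q⊆p (Out G v) A w∈) (∈─⇒∉ (Out G v) A w∈)

      by : ∀ q → owner G v ≡ q → Nonempty (Out G v ─ A)
      by q eq with own-or-opponent p q
      ... | inj₂ q≡ = ⊈⇒Nonempty-─ _ A λ out⊆ →
                        v∉A (Attr-opponent (v∈G , trans eq q≡) out⊆)
      ... | inj₁ q≡ with w , w∈ ← total v∈G (v∉A ∘ ⊆Attr) =
        w , x∈p∧x∉q⇒x∈p─q w∈ λ w∈A →
              v∉A (Attr-own (v∈G , trans eq q≡) (w , x∈p∩q⁺ (w∈ , w∈A)))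

-- Tails of plays.

tail : ∀ {A : Set} → ℕ → (ℕ → A) → ℕ → A
tail k π i = π (i + k)

Büchi-mono : ∀ {S T : Subset N} → S ⊆ T → ∀ π → Büchi S π → Büchi T π
Büchi-mono S⊆T π b i with j , i≤j , πj∈ ← b i = j , i≤j , S⊆T πj∈

Büchi-tail⁺ : ∀ (T : Subset N) k π → Büchi T π → Büchi T (tail k π)
-- Asking for a visit no earlier than `i + k` ensures `k ≤ j`, so the truncated subtraction is
-- exact.
Büchi-tail⁺ T k π b i with j , i+k≤j , πj∈ ← b (i + k) =
  j ∸ k , ℕ.m+n≤o⇒m≤o∸n i i+k≤j ,
  subst (λ m → π m ∈ T) (sym (ℕ.m∸n+n≡m (ℕ.m+n≤o⇒n≤o i i+k≤j))) πj∈

Büchi-tail⁻ : ∀ (T : Subset N) k π → Büchi T (tail k π) → Büchi T π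
Büchi-tail⁻ T k π b i with j , i≤j , πj∈ ← b i = j + k , ℕ.m≤n⇒m≤n+o k i≤j , πj∈

-- This direction serves player 2: refuting the objective on a tail refutes it on the whole play. As
-- `L` occurs negatively, both shifts of Büchi conditions enter.
GR1-tail : ∀ (L : Fin k₁ → Subset N) (U : Fin k₂ → Subset N) k π →
           GR1 L U π → GR1 L U (tail k π)
GR1-tail L U k π (inj₁ u)  = inj₁ λ ℓ → Büchi-tail⁺ (U ℓ) k π (u ℓ)
GR1-tail L U k π (inj₂ ¬l) = inj₂ λ l → ¬l λ t → Büchi-tail⁻ (L t) k π (l t)

-- Plays and strategies in a game graph.

module _ {G : Graph N} (game : IsGameGraph G) where
  open IsGameGraph game

  play-in-V : ∀ {π} → IsPlay G π → ∀ i → π i ∈ V G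
  play-in-V play zero    = IsPlay.start play
  play-in-V play (suc i) = target-in (IsPlay.step play i)

  tail-play : ∀ {π} → IsPlay G π → ∀ k → IsPlay G (tail k π)
  tail-play play k = record
    { start = play-in-V play k
    ; step  = λ i → IsPlay.step play (i + k)
    }

  anyEdge : Fin N → Fin N
  anyEdge v with nonempty? (Out G v)
  ... | yes (w , _) = w
  ... | no _        = v

  anyEdge-legal : ∀ {v} → v ∈ V G → anyEdge v ∈ Out G v
  anyEdge-legal {v} v∈ with nonempty? (Out G v)
  ... | yes (_ , w∈) = w∈
  ... | no empty     = contradiction (total v∈) empty

  firstMove : ∀ {p} v w → w ∈ Out G v → Strategy p G
  firstMove {p} v w w∈ = record { move = λ _ → mv ; legal = λ _ → ok }
    where
    mv : Fin N → Fin N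
    mv u with u ≟ v
    ... | yes _ = w
    ... | no _  = anyEdge u

    ok : ∀ {u} → u ∈V[ p ] G → mv u ∈ Out G u
    ok {u} (u∈ , _) with u ≟ v
    ... | yes refl = w∈
    ... | no _     = anyEdge-legal u∈

  firstMove-at : ∀ {p} v w (w∈ : w ∈ Out G v) past →
                 move (firstMove {p} v w w∈) past v ≡ w
  firstMove-at v w w∈ past with v ≟ v
  ... | yes _  = refl
  ... | no v≢v = contradiction refl v≢v

  module _ {p : Player} {H : Graph N} (Out⊆ : ∀ {u} → Out H u ⊆ Out G u)
           (σ : Strategy p H) where

    extend : Strategy p G
    extend = record { move = mv ; legal = ok }
      where
      mv : List (Fin N) → Fin N → Fin N
      mv past v with v ∈V[ p ]? H
      ... | yes _ = move σ past v
      ... | no _  = anyEdge v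

      ok : ∀ past {v} → v ∈V[ p ] G → mv past v ∈ Out G v
      ok past {v} (v∈ , _) with v ∈V[ p ]? H
      ... | yes v∈H = Out⊆ (legal σ past v∈H)
      ... | no _    = anyEdge-legal v∈

    extend-move : ∀ past {v} → v ∈V[ p ] H → move extend past v ≡ move σ past v
    extend-move past {v} v∈ with v ∈V[ p ]? H
    ... | yes _ = refl
    ... | no v∉ = contradiction v∈ v∉

    -- Conformity to `σ` constrains only the moves at `p`-vertices of `H`, where `extend` copies
    -- `σ`; hence `π` may be any sequence, even one that leaves `H`.
    extend-conforms : V H ⊆ V G → (∀ v → owner H v ≡ owner G v) →
                      ∀ {π} → Conforms extend π → Conforms σ π
    extend-conforms V⊆ own {π} conf i v∈@(πi∈ , o) =
      trans (conf i (V⊆ πi∈ , trans (sym (own (π i))) o)) (extend-move _ v∈)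

-- Exchanging the players and switching strategies.

unswap : ∀ {G : Graph N} → Strategy p1 (swap G) → Strategy p2 G
unswap σ = record
  { move  = move σ
  ; legal = λ past (v∈ , o) → legal σ past (v∈ , cong opponent o)
  }

unswap-conforms : ∀ {G : Graph N} (σ : Strategy p1 (swap G)) {π} →
                  Conforms (unswap σ) π → Conforms σ π
unswap-conforms {G = G} σ {π} conf i (πi∈ , o) with owner G (π i) in eq
-- An owner `p1` in `G` would be `p2` in `swap G`, against `o`.
... | p2 = conf i (πi∈ , eq)

-- Follow σ until the play first enters T, at e say, then follow τ e, which
-- is shown only the history since that visit of e.

module _ {G : Graph N} {p : Player} (T : Subset N)
         (τ : ∃[ e ] e ∈ T → Strategy p G) (σ : Strategy p G) where

  private
    -- `nothing` as long as `T` is unvisited; afterwards the first visited vertex of `T` with the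
    -- history since that visit, the visit itself being the start of a new play.
    Entry : Set
    Entry = Maybe ((∃[ e ] e ∈ T) × List (Fin N))

    atVertex : Fin N → Entry
    atVertex v with v ∈? T
    ... | yes v∈ = just ((v , v∈) , [])
    ... | no _   = nothing

    entry : List (Fin N) → Fin N → Entry
    entry [] v = atVertex v
    entry (u ∷ past) v with entry past u
    ... | just (e , past′) = just (e , u ∷ past′)
    ... | nothing          = atVertex v

    follow : Entry → List (Fin N) → Fin N → Fin N
    follow (just (e , past′)) past v = move (τ e) past′ v
    follow nothing            past v = move σ past v

    follow-legal : ∀ e past {v} → v ∈V[ p ] G → follow e past v ∈ Out G v
    follow-legal (just (e , past′)) past v∈ = legal (τ e) past′ v∈
    follow-legal nothing            past v∈ = legal σ past v∈

  switchOn : Strategy p G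
  switchOn = record
    { move  = λ past v → follow (entry past v) past v
    ; legal = λ past {v} → follow-legal (entry past v) past
    }

  module _ {π : ℕ → Fin N} where
    private
      atVertex-∉ : ∀ {v} → v ∉ T → atVertex v ≡ nothing
      atVertex-∉ {v} v∉ with v ∈? T
      ... | yes v∈ = contradiction v∈ v∉
      ... | no _   = refl

      atVertex-∈ : ∀ {v} → v ∈ T → ∃[ t ] atVertex v ≡ just ((v , t) , [])
      atVertex-∈ {v} v∈ with v ∈? T
      ... | yes t = t , refl
      ... | no v∉ = contradiction v∈ v∉

      entryAt : ℕ → Entry
      entryAt i = entry (applyDownFrom π i) (π i)

      before : ∀ k → (∀ i → i ≤ k → π i ∉ T) → entryAt k ≡ nothing
      before zero    avoid = atVertex-∉ (avoid 0 ℕ.≤-refl)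
      before (suc k) avoid
        rewrite before k (λ i i≤k → avoid i (ℕ.m≤n⇒m≤1+n i≤k)) =
        atVertex-∉ (avoid (suc k) ℕ.≤-refl)

      at : ∀ k → (∀ i → i < k → π i ∉ T) → entryAt k ≡ atVertex (π k)
      at zero    avoid = refl
      at (suc k) avoid rewrite before k (λ i i≤k → avoid i (s≤s i≤k)) = refl

      -- Each later step pushes `π (i + k)`, which is also the next head of the history of
      -- `tail k π`; so `τ e` sees exactly a play starting at time `k`.
      after : ∀ k {e} → entryAt k ≡ just (e , []) →
              ∀ i → entryAt (i + k) ≡ just (e , applyDownFrom (tail k π) i)
      after k eq zero = eq
      after k eq (suc i) rewrite after k eq i = refl

    switchOn-before : Conforms switchOn π → (∀ i → π i ∉ T) → Conforms σ π
    switchOn-before conf avoid i v∈ =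
      trans (conf i v∈)
            (cong (λ e → follow e (applyDownFrom π i) (π i)) (before i λ j _ → avoid j))

    switchOn-after : Conforms switchOn π → ∀ k → (∀ i → i < k → π i ∉ T) → π k ∈ T →
                     ∃[ t ] Conforms (τ (π k , t)) (tail k π)
    switchOn-after conf k avoid πk∈ with t , eq ← atVertex-∈ πk∈ =
      t , λ i v∈ → trans (conf (i + k) v∈)
            (cong (λ e → follow e (applyDownFrom π (i + k)) (π (i + k)))
                  (after k (trans (at k avoid) eq) i))

-- The claim is negative, so it suffices to refute every first visit
-- to T and then assume that T is never visited.

module _ {G : Graph N} (game : IsGameGraph G) {ψ : Objective N}
         (ψ-tail : ∀ k π → ψ π → ψ (tail k π)) where

  win-by-switch : (T : Subset N) → (∀ {v} → v ∈ T → W p2 G ψ v) →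
    ∀ {v} → v ∈ V G → (σ : Strategy p2 G) →
    (∀ π → IsPlay G π → π 0 ≡ v → Conforms σ π → (∀ i → π i ∉ T) → ¬ ψ π) →
    W p2 G ψ v
  win-by-switch T winT {v} v∈ σ winσ = v∈ , ρ , wins
    where
    τ : ∃[ e ] e ∈ T → Strategy p2 G
    τ (e , e∈) = proj₁ (proj₂ (winT e∈))

    ρ = switchOn T τ σ

    wins : WinsFrom p2 G (¬_ ∘ ψ) ρ v
    wins π play π0≡v conf ψπ =
      winσ π play π0≡v (switchOn-before T τ σ conf avoid) avoid ψπ
      where
      avoid : ∀ i → π i ∉ T
      -- Strong induction makes `k` the first visit. From there the strategy for `π k` refutes `ψ`
      -- on the tail, while `ψ-tail` gives `ψ` on it.
      avoid = ℕ.<-rec (λ i → π i ∉ T) λ k before πk∈ →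
        let t , conf′ = switchOn-after T τ σ conf k (λ i i<k → before i<k) πk∈
        in proj₂ (proj₂ (winT t)) (tail k π) (tail-play game play k) refl conf′
             (ψ-tail k π ψπ)

  -- From a vertex new in level `suc j`, the first move leads into level `j`, by player 2's choice
  -- or because player 1 has no alternative. So no play avoids level `j` beyond index 0, and
  -- switching there uses the induction hypothesis.
  Attr-wins : (S : Subset N) → (∀ {v} → v ∈ S → W p2 G ψ v) →
              ∀ {v} → v ∈ Attr p2 G S → W p2 G ψ v
  Attr-wins S winS = level N
    where
    level : ∀ j {v} → v ∈ R p2 G S j → W p2 G ψ v
    level zero    v∈ = winS v∈
    level (suc j) {v} v∈ with Equivalence.to (∈⟪⟫ (attrStep? p2 G (R p2 G S j))) v∈
    ... | inj₁ v∈Rj = level j v∈Rj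
    ... | inj₂ (inj₁ (v∈₂ , w , w∈))
      with w∈Out , w∈Rj ← x∈p∩q⁻ (Out G v) (R p2 G S j) w∈ =
      win-by-switch (R p2 G S j) (level j) (proj₁ v∈₂) (firstMove game v w w∈Out)
        λ { π play refl conf avoid _ → avoid 1
              (subst (_∈ R p2 G S j)
                     (sym (trans (conf 0 v∈₂) (firstMove-at game {p2} v w w∈Out [])))
                     w∈Rj) }
    ... | inj₂ (inj₂ ((v∈V , _) , out⊆)) =
      win-by-switch (R p2 G S j) (level j) v∈V
        -- Player 1 moves at `v`, so any strategy of player 2 will do here.
        (firstMove game v _ (proj₂ (IsGameGraph.total game v∈V)))
        λ { π play refl conf avoid _ → avoid 1 (out⊆ (IsPlay.step play 0)) }

  -- A play of `G` that avoids `D` is a play of `G ∖ D`, where `σ` refutes `ψ′`. A separate `ψ′`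
  -- allows for targets from which `D` has been removed.
  ∖-wins : (D : Subset N) → (∀ {v} → v ∈ D → W p2 G ψ v) →
           ∀ {ψ′ : Objective N} → (∀ π → IsPlay (G ∖ D) π → ψ π → ψ′ π) →
           ∀ {v} → W p2 (G ∖ D) ψ′ v → W p2 G ψ v
  ∖-wins D winD ψ⇒ψ′ {v} (v∈ , σ , win) =
    win-by-switch D winD (V⊆ v∈) (extend game Out⊆ σ)
      λ { π play refl conf avoid ψπ →
            let play′ = record
                  { start = v∈
                  ; step  = λ i → ∈Out-∖⁺ G D (avoid i) (IsPlay.step play i) (avoid (suc i))
                  }
            in win π play′ refl (extend-conforms game Out⊆ σ V⊆ (λ _ → refl) conf)
                 (ψ⇒ψ′ π play′ ψπ) }
    where
    V⊆ : V (G ∖ D) ⊆ V G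
    V⊆ = p─q⊆p (V G) D

    Out⊆ : ∀ {u} → Out (G ∖ D) u ⊆ Out G u
    Out⊆ w∈ = proj₁ (proj₂ (∈Out-∖⁻ G D w∈))

-- Winning outside a player-1 attractor.

swap-game : ∀ {G : Graph N} → IsGameGraph G → IsGameGraph (swap G)
swap-game game = record { IsGameGraph game }

-- The edges O may lack some edges of G, but outside X they leave player 1 all
-- her choices and player 2 at least one.

module _ {G : Graph N} (game : IsGameGraph G) (O : Fin N → Subset N) (X : Subset N)
         (O⊆ : ∀ {u} → O u ⊆ Out G u)
         (keeps : ∀ {v} → v ∈V[ p1 ] G → v ∉ X → Out G v ⊆ O v)
         (total₂ : ∀ {v} → v ∈V[ p2 ] G → v ∉ X → Nonempty (O v)) where

  private
    K : Graph N
    K = record { V = V G ; Out = O ; owner = owner G }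

    Y = Attr p1 K X

    H = K ∖ Y

  trap-game : IsGameGraph H
  trap-game = ∖Attr-game p1 K X
    (λ v∈ → IsGameGraph.source-in game (O⊆ v∈) , IsGameGraph.target-in game (O⊆ v∈))
    totalK
    where
    totalK : ∀ {v} → v ∈ V G → v ∉ X → Nonempty (O v)
    totalK {v} v∈ v∉ with owner G v in eq
    ... | p2 = total₂ (v∈ , eq) v∉
    ... | p1 with w , w∈ ← IsGameGraph.total game v∈ = w , keeps (v∈ , eq) v∉ w∈

  -- At a vertex outside `Y`, player 1's edges in `G` all belong to `K` and none enters `Y`, while
  -- player 2 moves by a strategy of `H`. Hence a play in `G` stays in `H`, although `K` may have
  -- fewer edges than `G`.
  trap-wins : ∀ (L : Fin k₁ → Subset N) (U : Fin k₂ → Subset N) ℓ → U ℓ ⊆ X →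
              ∀ {v} → W p1 (swap H) (GenBüchi (λ t → L t ─ Y)) v → W p2 G (GR1 L U) v
  trap-wins L U ℓ Uℓ⊆X {v} (v∈ , σ′ , win) =
    p─q⊆p (V G) Y v∈ , extend game Out⊆ σ , wins
    where
    σ : Strategy p2 H
    σ = unswap σ′

    Out⊆ : ∀ {u} → Out H u ⊆ Out G u
    Out⊆ w∈ = O⊆ (proj₁ (proj₂ (∈Out-∖⁻ K Y w∈)))

    V⊆ : V H ⊆ V G
    V⊆ = p─q⊆p (V G) Y

    wins : WinsFrom p2 G (¬_ ∘ GR1 L U) (extend game Out⊆ σ) v
    wins π play π0≡v conf = λ
      { (inj₁ u)  → let j , _ , πj∈ = u ℓ 0
                    in ∈─⇒∉ (V G) Y (stays j) (⊆Attr p1 K X (Uℓ⊆X πj∈))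
      ; (inj₂ ¬l) → ¬l λ t → Büchi-mono (p─q⊆p (L t) Y) π
                      (win π play′ π0≡v (unswap-conforms σ′ conf′) t)
      }
      where
      π0∈ : π 0 ∈ V H
      π0∈ = subst (_∈ V H) (sym π0≡v) v∈

      conf′ : Conforms σ π
      conf′ = extend-conforms game Out⊆ σ V⊆ (λ _ → refl) conf

      stepH : ∀ i → π i ∈ V H → π (suc i) ∈ Out H (π i)
      stepH i πi∈ with owner G (π i) in eq
      ... | p2 = subst (_∈ Out H (π i)) (sym (conf′ i (πi∈ , eq)))
                       (legal σ (applyDownFrom π i) (πi∈ , eq))
      ... | p1 = ∈Out-∖⁺ K Y πi∉Y next∈ λ next∈Y →
                   πi∉Y (Attr-own p1 K X πi∈₁ (_ , x∈p∩q⁺ (next∈ , next∈Y)))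
        where
        πi∈₁ : π i ∈V[ p1 ] G
        πi∈₁ = V⊆ πi∈ , eq
        πi∉Y = ∈─⇒∉ (V G) Y πi∈
        next∈ = keeps πi∈₁ (πi∉Y ∘ ⊆Attr p1 K X) (IsPlay.step play i)

      stays : ∀ i → π i ∈ V H
      stays zero    = π0∈
      stays (suc i) = IsGameGraph.target-in trap-game (stepH i (stays i))

      play′ : IsPlay (swap H) π
      play′ = record { start = π0∈ ; step = λ i → stepH i (stays i) }

-- The sets computed by the algorithm, and its iterations.

module _ (sub : Subroutines N) where
  open Subroutines sub
  open Algorithm sub

  module _ {G : Graph N} (game : IsGameGraph G)
           (L : Fin k₁ → Subset N) (L⊆ : ∀ t → L t ⊆ V G) (U : Fin k₂ → Subset N) where

    open DecMembership (_≟_ {N}) using () renaming (_∈?_ to _∈ˡ?_)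
    open Dominion G U L using (Gᵢ; Zᵢ; Yᵢ; Xᵢ)

    genBüchiGame-wins : ∀ ℓ {v} →
      let Y = Attr p1 G (U ℓ) in
      v ∈ genBüchiGame (swap (G ∖ Y)) (λ t → L t ─ Y) → W p2 G (GR1 L U) v
    genBüchiGame-wins ℓ v∈ =
      trap-wins game (Out G) (U ℓ) (λ w∈ → w∈) keeps total₂ L U ℓ (λ w∈ → w∈)
        (Equivalence.to (genBüchiGame-spec _ (swap-game H-game) _
                           (λ t → ─-monoˡ _ (L⊆ t)) _) v∈)
      where
      keeps : ∀ {v} → v ∈V[ p1 ] G → v ∉ U ℓ → Out G v ⊆ Out G v
      keeps _ _ w∈ = w∈
      total₂ : ∀ {v} → v ∈V[ p2 ] G → v ∉ U ℓ → Nonempty (Out G v)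
      total₂ (v∈ , _) _ = IsGameGraph.total game v∈
      H-game = trap-game game (Out G) (U ℓ) (λ w∈ → w∈) keeps total₂

    -- `Zᵢ i` covers the vertices where passing to `Gᵢ i` could break the trap: player-2 vertices
    -- left without edges, and player-1 vertices of outdegree above `2 ^ i`, which may have lost
    -- some.
    Xᵢ-wins : ∀ i ℓ {v} → v ∈ Xᵢ i ℓ → W p2 G (GR1 L U) v
    Xᵢ-wins i ℓ {v} v∈ = by-contract
      (progressMeasure-sound (swap (Gᵢ i ∖ Yᵢ i ℓ))
         (swap-game (trap-game game (Out (Gᵢ i)) X Out⊆ keeps total₂))
         (λ t → L t ─ Yᵢ i ℓ) (λ t → ─-monoˡ _ (L⊆ t)) (2 ^ i))
      where
      X = U ℓ ∪ Zᵢ i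

      -- This and the next two predicates repeat those inlined in `decomp` and `Zᵢ`, so that `∈⟪⟫`
      -- can be applied to them.
      edge? : ∀ u → Decidable λ v →
        v ∈ Out G u × (Outdeg G u ≤ 2 ^ i ⊎ u ∈ˡ take (2 ^ i) (inOrder G v))
      edge? u v =
        (v ∈? Out G u) ×-dec ((Outdeg G u ≤? 2 ^ i) ⊎-dec (u ∈ˡ? take (2 ^ i) (inOrder G v)))

      sink₂? : Decidable λ v → v ∈V[ p2 ] G × Outdeg (Gᵢ i) v ≡ 0
      sink₂? v = (v ∈V[ p2 ]? G) ×-dec (Outdeg (Gᵢ i) v ℕ.≟ 0)

      large₁? : Decidable λ v → v ∈V[ p1 ] G × 2 ^ i < Outdeg G v
      large₁? v = (v ∈V[ p1 ]? G) ×-dec (2 ^ i <? Outdeg G v)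

      U⊆X : U ℓ ⊆ X
      U⊆X = p⊆p∪q (Zᵢ i)

      Out⊆ : ∀ {u} → Out (Gᵢ i) u ⊆ Out G u
      Out⊆ {u} w∈ = proj₁ (Equivalence.to (∈⟪⟫ (edge? u)) w∈)

      keeps : ∀ {v} → v ∈V[ p1 ] G → v ∉ X → Out G v ⊆ Out (Gᵢ i) v
      keeps {v} v∈₁ v∉X w∈ =
        Equivalence.from (∈⟪⟫ (edge? v)) (w∈ , inj₁ (ℕ.≮⇒≥ λ 2^i< →
          v∉X (x∈p∪q⁺ (inj₂ (x∈p∪q⁺ (inj₂
            (Equivalence.from (∈⟪⟫ large₁?) (v∈₁ , 2^i<))))))))

      total₂ : ∀ {v} → v ∈V[ p2 ] G → v ∉ X → Nonempty (Out (Gᵢ i) v)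
      total₂ v∈₂ v∉X = ∣p∣≢0⇒Nonempty _ λ deg≡0 →
        v∉X (x∈p∪q⁺ (inj₂ (x∈p∪q⁺ (inj₁
          (Equivalence.from (∈⟪⟫ sink₂?) (v∈₂ , deg≡0))))))

      by-contract : _ → W p2 G (GR1 L U) v
      by-contract (inj₁ empty) = contradiction (_ , v∈) empty
      by-contract (inj₂ dom) with σ , win ← IsDominion₁.winning dom v∈ =
        trap-wins game (Out (Gᵢ i)) X Out⊆ keeps total₂ L U ℓ U⊆X
          (IsDominion₁.within dom v∈ , σ ,
           λ π play π0≡v conf → proj₁ (win π play π0≡v conf))

    D-wins : ∀ n {v} →
      v ∈ Iteration.D n (record { graph = G ; Us = U ; Ls = L }) → W p2 G (GR1 L U) v
    D-wins n = Attr-wins game (GR1-tail L U) S S-wins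
      where
      st : State N _ _
      st = record { graph = G ; Us = U ; Ls = L }

      open Iteration n st using (S; Y)

      direct : Fin _ → Subset N
      direct ℓ = genBüchiGame (swap (G ∖ Y ℓ)) (λ t → L t ─ Y ℓ)

      S-wins : ∀ {v} → v ∈ S → W p2 G (GR1 L U) v
      S-wins v∈ with ∈firstNonempty⁻ (kGenBüchiDominion G U L n) (map direct (allFin _)) v∈
      ... | inj₁ v∈X
        with i , v∈Xᵢ ← ∈firstNonempty-map⁻ (λ i → firstNonempty (map (Xᵢ i) (allFin _)))
                          (map suc (upTo ⌈log₂2√ n ⌉)) v∈X
        with ℓ , v∈Xᵢℓ ← ∈firstNonempty-map⁻ (Xᵢ i) (allFin _) v∈Xᵢ = Xᵢ-wins i ℓ v∈Xᵢℓ
      ... | inj₂ v∈B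
        with ℓ , v∈Bℓ ← ∈firstNonempty-map⁻ direct (allFin _) v∈B = genBüchiGame-wins ℓ v∈Bℓ

  module _ (n : ℕ) (st : State N k₁ k₂)
           (game : IsGameGraph (graph st)) (L⊆ : ∀ t → Ls st t ⊆ V (graph st)) where
    open Iteration n st

    next-game : IsGameGraph (graph next)
    next-game = ∖Attr-game p2 (graph st) S
      (λ v∈ → IsGameGraph.source-in game v∈ , IsGameGraph.target-in game v∈)
      (λ v∈ _ → IsGameGraph.total game v∈)

    next-wins : ∀ {v} → W p2 (graph next) (GR1 (Ls next) (Us next)) v →
                W p2 (graph st) (GR1 (Ls st) (Us st)) v
    next-wins = ∖-wins game (GR1-tail (Ls st) (Us st)) D
      (D-wins game (Ls st) L⊆ (Us st) n) λ
        -- The play never meets `D`, so its visits to `U ℓ` survive the removal of `D`; for the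
        -- negated `L` it is enough that removal shrinks the targets.
        { π play (inj₁ u)  → inj₁ λ ℓ i →
            let j , i≤j , πj∈ = u ℓ i
            in j , i≤j , x∈p∧x∉q⇒x∈p─q πj∈ (∈─⇒∉ _ D (play-in-V next-game play j))
        ; π play (inj₂ ¬l) → inj₂ λ l →
            ¬l λ t → Büchi-mono (p─q⊆p (Ls st t) D) π (l t)
        }

  module _ {G : Graph N} (game : IsGameGraph G)
           (L : Fin k₁ → Subset N) (L⊆ : ∀ t → L t ⊆ V G) (U : Fin k₂ → Subset N) where
    open Run G U L

    state-game : ∀ j → IsGameGraph (graph (state j)) × (∀ t → Ls (state j) t ⊆ Vʲ j)
    state-game zero = game , L⊆
    state-game (suc j) with gameʲ , L⊆ʲ ← state-game j =
      next-game ∣ V G ∣ (state j) gameʲ L⊆ʲ , λ t → ─-monoˡ _ (L⊆ʲ t)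

    -- Induction on the number `d` of iterations still to come, with `j` varying: `v` lies in
    -- `Dʲ j`, or it survives into the next state and its win there is carried back by `next-wins`.
    removed-wins : ∀ d j {v} → v ∈ Vʲ j → v ∉ Vʲ (d + j) →
                   W p2 (graph (state j)) (GR1 (Ls (state j)) (Us (state j))) v
    removed-wins zero    j v∈ v∉ = contradiction v∈ v∉
    removed-wins (suc d) j {v} v∈ v∉
      with gameʲ , L⊆ʲ ← state-game j
      with v ∈? Dʲ j
    ... | yes v∈D = D-wins gameʲ (Ls (state j)) L⊆ʲ (Us (state j)) ∣ V G ∣ v∈D
    ... | no v∉D  = next-wins ∣ V G ∣ (state j) gameʲ L⊆ʲ
      (removed-wins d (suc j) (x∈p∧x∉q⇒x∈p─q v∈ v∉D)
         (subst (λ m → v ∉ Vʲ m) (sym (ℕ.+-suc d j)) v∉))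

lemma5p22 : ∀ {N k₁ k₂ : ℕ} (sub : Subroutines N)
    (G : Graph N) → IsGameGraph G →
    (L : Fin k₁ → Subset N) → (∀ t → L t ⊆ V G) →
    (U : Fin k₂ → Subset N) → (∀ ℓ → U ℓ ⊆ V G) →
    ∀ V* → Algorithm.GR1GameReturns sub G L U V* →
    ∀ v → v ∈ V G → v ∉ V* → W p2 G (GR1 L U) v
lemma5p22 sub G game L L⊆ U U⊆ V* (j , _ , V*≡) v v∈ v∉ =
  -- All `j` iterations are traversed from the initial state, so the final set appears as
  -- `Vʲ (j + 0)`.
  removed-wins sub game L L⊆ U j 0 v∈
    (subst (v ∉_) (trans V*≡ (cong Vʲ (sym (ℕ.+-identityʳ j)))) v∉)
  where open Algorithm.Run sub G U L using (Vʲ)
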